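{- Let $\langle E_1,\ldots,E_n,op_1,\ldots,op_p\rangle$ be a structure. Suppose that for all families of sets $F_1,\ldots,F_{m+1}$ and all indexings $i_1,\ldots,i_{m+1}$ and $i'_1,\ldots,i'_{m+1}$ of this family such that for all $k$ either $i_k=i'_k$, or $F_k$ is some $E_l$ and $i_k$ and $i'_k$ are extracted from two admissible indexings of the structure $\langle E_1,\ldots,E_n,op_1,\ldots,op_p\rangle$ (that is, they are the $l$-th components of two such admissible indexings), the set of functions from $F_1\times\ldots\times F_m$ to $F_{m+1}$ that are computable relatively to $i_1,\ldots,i_{m+1}$ is the same as the set of those computable relatively to $i'_1,\ldots,i'_{m+1}$. Then computability is stable over the structure $\langle E_1,\ldots,E_n,op_1,\ldots,op_p\rangle$.
   Context: Computability over natural numbers is the usual one. A set $A \subseteq \mathbb{N}$ is effectively enumerable if it is empty or the image of a total computable function from $\mathbb{N}$ to $\mathbb{N}$. For $A \subseteq \mathbb{N}^m$ and $B \subseteq \mathbb{N}$, a computable function from $A$ to $B$ is a partial computable function that is defined at every element of $A$ and takes values in $B$ there. Indexing: an indexing of a set $E$ is a partial function $i$ from $\mathbb{N}$ to $E$ such that $dom(i)$ is effectively enumerable, $i$ is surjective, and there is a computable function $eq$ from $dom(i)\times dom(i)$ to $\{0,1\}$ with $eq(x,y)=1$ if $i(x)=i(y)$ and $eq(x,y)=0$ otherwise. An indexing of a family of sets $E_1,\ldots,E_n$ is a family $i_1,\ldots,i_n$ of indexings of $E_1,\ldots,E_n$. Computable function: given sets $E_1,\ldots,E_m,E_{m+1}$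 with indexings $i_1,\ldots,i_{m+1}$, a function $f: E_1\times\ldots\times E_m \to E_{m+1}$ is computable relatively to this indexing if there is a computable function $\hat f$ from $dom(i_1)\times\ldots\times dom(i_m)$ to $dom(i_{m+1})$ such that $i_{m+1}(\hat f(x_1,\ldots,x_m)) = f(i_1(x_1),\ldots,i_m(x_m))$ for all $x_k \in dom(i_k)$. Admissible indexing: a structure $\langle E_1,\ldots,E_n,op_1,\ldots,op_p\rangle$ consists of sets $E_1,\ldots,E_n$ and operations, each from a product of some of these sets to one of these sets. An indexing of it is an indexing of $E_1,\ldots,E_n$; it is admissible if every $op_k$ is computable relatively to the indexings of its domains and co-domain. Stable computability: computability is stable over $\langle E_1,\ldots,E_n,op_1,\ldots,op_p\rangle$ if there exists an admissible indexing of this structure and, for all admissible indexings $j_1,\ldots,j_n$ and $j'_1,\ldots,j'_n$ of it, there exist computable functions $h_k$ from $dom(j'_k)$ to $dom(j_k)$ such that $j'_k = j_k\circ h_k$, for $k=1,\ldots,n$.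
   Formalization: The formal theorem additionally assumes that the structure has at least one admissible indexing; without this the claim fails, e.g. for a single uncountable set with no operations, where the supposition holds trivially but stability requires an admissible indexing to exist. -}

module Defs where

open import Data.Fin using (Fin; zero; suc; inject₁; fromℕ)
open import Data.Nat using (ℕ; zero; suc; _<_)
open import Data.Product using (Σ-syntax; ∃; ∃-syntax; _×_; _,_)
open import Data.Sum using (_⊎_)
open import Data.Unit using (⊤)
open import Data.Unit.Polymorphic using () renaming (⊤ to ⊤ₗ)
open import Data.Vec using (Vec; []; _∷_; lookup)
open import Function using (_∘_; _⇔_)
open import Level using (Level; _⊔_) renaming (suc to lsuc)
open import Relation.Binary.PropositionalEquality using (_≡_; _≢_)
open import Relation.Nullary using (¬_)

private
  variable
    a b ℓ : Level
    m n : ℕ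

-- Codes for the partial recursive (μ-recursive) functions of arity n.
data PR : ℕ → Set where
  zeroᶜ : PR 0
  sucᶜ  : PR 1
  proj  : Fin n → PR n
  comp  : PR m → Vec (PR n) m → PR n
  rec   : PR n → PR (suc (suc n)) → PR (suc n)
  mu    : PR (suc n) → PR n

infix 4 _[_]⇓_ _[_]⇓*_

-- p [ xs ]⇓ y : the partial function coded by p is defined at xs, with value y.
mutual
  data _[_]⇓_ : PR n → Vec ℕ n → ℕ → Set where
    ⇓zero : zeroᶜ [ [] ]⇓ 0
    ⇓suc  : ∀ {x} → sucᶜ [ x ∷ [] ]⇓ suc x
    ⇓proj : ∀ {k : Fin n} {xs} → proj k [ xs ]⇓ lookup xs k
    ⇓comp : ∀ {f : PR m} {gs : Vec (PR n) m} {xs ys y} →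
            gs [ xs ]⇓* ys → f [ ys ]⇓ y → comp f gs [ xs ]⇓ y
    ⇓rec0 : ∀ {f : PR n} {g xs y} →
            f [ xs ]⇓ y → rec f g [ 0 ∷ xs ]⇓ y
    ⇓recs : ∀ {f : PR n} {g xs k r y} →
            rec f g [ k ∷ xs ]⇓ r → g [ k ∷ r ∷ xs ]⇓ y →
            rec f g [ suc k ∷ xs ]⇓ y
    ⇓mu   : ∀ {f : PR (suc n)} {xs y} →
            (∀ z → z < y → ∃[ v ] f [ z ∷ xs ]⇓ suc v) →
            f [ y ∷ xs ]⇓ 0 → mu f [ xs ]⇓ y

  data _[_]⇓*_ : Vec (PR n) m → Vec ℕ n → Vec ℕ m → Set where
    []  : ∀ {xs : Vec ℕ n} → [] [ xs ]⇓* []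
    _∷_ : ∀ {g : PR n} {gs : Vec (PR n) m} {xs y ys} →
          g [ xs ]⇓ y → gs [ xs ]⇓* ys → (g ∷ gs) [ xs ]⇓* (y ∷ ys)

infix 4 _∶_⟶_

-- p codes a computable function from A ⊆ ℕᵐ to B ⊆ ℕ; nothing is required
-- of p outside A.
_∶_⟶_ : PR m → (Vec ℕ m → Set a) → (ℕ → Set b) → Set (a ⊔ b)
p ∶ A ⟶ B = ∀ xs → A xs → ∃[ y ] (p [ xs ]⇓ y × B y)

EffectivelyEnumerable : (ℕ → Set a) → Set a
EffectivelyEnumerable A =
  (∀ x → ¬ A x)
  ⊎ (Σ[ f ∈ PR 1 ] ((f ∶ (λ _ → ⊤) ⟶ (λ _ → ⊤))
                    × (∀ y → A y ⇔ (∃[ x ] f [ x ∷ [] ]⇓ y))))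

-- Partial functions from ℕ to E, as functional relations.
record PartialFunction (E : Set ℓ) : Set (lsuc ℓ) where
  field
    graph      : ℕ → E → Set ℓ
    functional : ∀ {x e e′} → graph x e → graph x e′ → e ≡ e′

record Indexing (E : Set ℓ) : Set (lsuc ℓ) where
  field
    partialFunction : PartialFunction E

  open PartialFunction partialFunction public

  Dom : ℕ → Set ℓ
  Dom x = ∃[ e ] graph x e

  field
    dom-enumerable : EffectivelyEnumerable Dom
    surjective     : ∀ e → ∃[ x ] graph x e
    eq             : PR 2
    eq-correct     : ∀ {x y e e′} → graph x e → graph y e′ →
                     (e ≡ e′ × eq [ x ∷ y ∷ [] ]⇓ 1)
                     ⊎ (e ≢ e′ × eq [ x ∷ y ∷ [] ]⇓ 0)

open Indexing public using (graph; Dom)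

infix 4 _≐_

-- Equality of indexings is equality of the underlying partial functions; the
-- witnesses carried by the remaining fields of Indexing are irrelevant to it.
_≐_ : {E : Set ℓ} → Indexing E → Indexing E → Set ℓ
i ≐ i′ = ∀ x e → graph i x e ⇔ graph i′ x e

Product : (Fin m → Set ℓ) → Set ℓ
Product {zero}  F = ⊤ₗ
Product {suc m} F = F zero × Product (F ∘ suc)

component : {F : Fin m → Set ℓ} → Product F → ∀ k → F k
component (e , es) zero    = e
component (e , es) (suc k) = component es k

-- For a family F₁, …, Fₘ₊₁: functions F₁ × … × Fₘ → Fₘ₊₁.
Operation : (Fin (suc m) → Set ℓ) → Set ℓ
Operation {m} F = Product (F ∘ inject₁) → F (fromℕ m)

Computable : {F : Fin (suc m) → Set ℓ} →
             (∀ k → Indexing (F k)) → Operation F → Set ℓ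
Computable {m} {F = F} i f =
  Σ[ f̂ ∈ PR m ]
    ((f̂ ∶ (λ xs → ∀ k → Dom (i (inject₁ k)) (lookup xs k)) ⟶ Dom (i (fromℕ m)))
     × (∀ {xs y} (es : Product (F ∘ inject₁)) →
          (∀ k → graph (i (inject₁ k)) (lookup xs k) (component es k)) →
          f̂ [ xs ]⇓ y → graph (i (fromℕ m)) y (f es)))

record Structure ℓ : Set (lsuc ℓ) where
  field
    #sets : ℕ
    E     : Fin #sets → Set ℓ
    #ops  : ℕ
    arity : Fin #ops → ℕ
    -- The arguments of op k range over E (sort k 0), …, E (sort k (arity k - 1));
    -- its values lie in E (sort k (arity k)).
    sort  : ∀ k → Fin (suc (arity k)) → Fin #sets
    op    : ∀ k → Operation (E ∘ sort k)

module _ (S : Structure ℓ) where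
  open Structure S

  Admissible : (∀ l → Indexing (E l)) → Set ℓ
  Admissible j = ∀ k → Computable (j ∘ sort k) (op k)

  StableComputability : Set (lsuc ℓ)
  StableComputability =
    ∃ Admissible
    × (∀ j j′ → Admissible j → Admissible j′ → ∀ k →
         Σ[ h ∈ PR 1 ]
           ((h ∶ (λ { (x ∷ []) → Dom (j′ k) x }) ⟶ Dom (j k))
            × (∀ {x y e} → graph (j′ k) x e → h [ x ∷ [] ]⇓ y → graph (j k) y e)))

  data Exchangeable : {F : Set ℓ} → Indexing F → Indexing F → Set (lsuc ℓ) where
    equal     : ∀ {F} {i i′ : Indexing F} → i ≐ i′ → Exchangeable i i′
    extracted : ∀ j j′ → Admissible j → Admissible j′ →
                ∀ l {i i′ : Indexing (E l)} → i ≐ j l → i′ ≐ j′ l →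
                Exchangeable i i′

  SameComputableFunctions : Set (lsuc ℓ)
  SameComputableFunctions =
    ∀ m (F : Fin (suc m) → Set ℓ) (i i′ : ∀ k → Indexing (F k)) →
    (∀ k → Exchangeable (i k) (i′ k)) →
    ∀ (f : Operation F) → Computable i f ⇔ Computable i′ f

{-# OPTIONS --safe #-}
-- The identity of E k is computable relatively to j′ k on both sides, hence, by
-- hypothesis, also when the indexing of its codomain alone is exchanged for
-- j k.  A code for it relatively to this mixed pair of indexings is the
-- required translation h.
module Submission where

open import Defs
open import Data.Fin using (Fin; zero; suc)
open import Data.Product using (∃; _,_; proj₁)
open import Data.Vec using ([]; _∷_)
open import Function using (Equivalence)
open import Function.Properties.Equivalence using (⇔-isEquivalence)
open import Relation.Binary.Structures using (IsEquivalence)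

≐-refl : ∀ {ℓ} {E : Set ℓ} {i : Indexing E} → i ≐ i
≐-refl _ _ = IsEquivalence.refl ⇔-isEquivalence

-- Position 0 indexes the argument of a unary operation, position 1 its value.
pair : ∀ {ℓ} {E : Set ℓ} → Indexing E → Indexing E → (k : Fin 2) → Indexing E
pair i i′ zero    = i
pair i i′ (suc _) = i′

identity : ∀ {ℓ} {E : Set ℓ} → Operation {1} (λ _ → E)
identity = proj₁

identity-computable : ∀ {ℓ} {E : Set ℓ} (i : Indexing E) →
                      Computable (pair i i) identity
identity-computable i =
  proj zero , (λ { (x ∷ []) dom → x , ⇓proj , dom zero }) ,
  λ { {x ∷ []} (e , _) g ⇓proj → g zero }

-- With no admissible indexing, only equal indexings are `Exchangeable` and
-- `SameComputableFunctions` holds trivially; existence is therefore assumed separately.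
proposition3 : ∀ {ℓ} (S : Structure ℓ) → ∃ (Admissible S) → SameComputableFunctions S → StableComputability S
proposition3 S admissible same = admissible , translation
  where
  open Structure S

  translation : ∀ j j′ → Admissible S j → Admissible S j′ → ∀ k → _
  translation j j′ adm adm′ k =
    let h , h-total , h-correct =
          Equivalence.to
            (same 1 (λ _ → E k) (pair (j′ k) (j′ k)) (pair (j′ k) (j k)) exchangeable identity)
            (identity-computable (j′ k))
    in h , (λ { (x ∷ []) dom → h-total (x ∷ []) (λ { zero → dom }) }) ,
       -- `identity` sends the one-entry tuple `(e , _)` to `e`, so the output `y` denotes `e` under
       -- `j k`.
       λ {x} {y} {e} g → h-correct {x ∷ []} (e , _) (λ { zero → g })
    where
    exchangeable : ∀ l → Exchangeable S (pair (j′ k) (j′ k) l) (pair (j′ k) (j k) l)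
    exchangeable zero    = equal (≐-refl {i = j′ k})
    exchangeable (suc _) =
      extracted j′ j adm′ adm k (≐-refl {i = j′ k}) (≐-refl {i = j k})
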